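{- Let $(\rho_n)_{n\geqslant 0}$ be a sequence of non-zero numbers with $\rho_0=1$, and let $(K_m(x))_{m\geqslant 0}$ be a sequence of polynomials in $x$. For $n\geqslant 1$ let $F_n(x)=\det H_n(x)$, where $H_n(x)=(h_{ij})_{1\leqslant i,j\leqslant n}$ is the matrix with $$h_{ij}=\begin{cases}\dfrac{\rho_i}{\rho_{j-1}\rho_{i-j+1}}K_{i-j}(x), & 1\leqslant j\leqslant i,\\ -1, & j=i+1,\\ 0, & j>i+1.\end{cases}$$ Let $F(x;z)=1+\sum_{n\geqslant 1}F_n(x)\frac{z^n}{\rho_n}$. Then $$F(x;z)=\frac{1}{1-K(x;z)},\qquad\text{where } K(x;z)=\sum_{m\geqslant0}K_m(x)\frac{z^{m+1}}{\rho_{m+1}}.$$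
   Context: Generating functions are formal power series in $z$ whose coefficients are polynomials in $x$. -}

module Defs where

open import Algebra.Apartness.Bundles using (HeytingCommutativeRing; HeytingField)
open import Algebra.Bundles using (CommutativeRing)
open import Algebra.Bundles.Raw using (RawRing)
open import Algebra.Apartness.Properties.HeytingCommutativeRing using (x#0y#0→xy#0)
import Algebra.Definitions.RawMonoid as RawMonoidDefs
import Algebra.Definitions.RawSemiring as RawSemiringDefs
open import Data.Bool.Base using (if_then_else_)
open import Data.Fin.Base using (Fin; zero; suc; toℕ; punchIn)
open import Data.List.Base using (List; []; _∷_; map)
open import Data.Nat.Base as ℕ using (ℕ; zero; suc; _∸_; _≤ᵇ_; _≡ᵇ_)
open import Data.Product.Base using (_×_; proj₁)

module Polynomial {c ℓ} (R : RawRing c ℓ) where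
  open RawRing R

  -- The list a₀ ∷ a₁ ∷ … ∷ [] stands for a₀ + a₁x + ….  Trailing zeros are
  -- allowed, so equality compares coefficients.
  Poly : Set c
  Poly = List Carrier

  coeff : Poly → ℕ → Carrier
  coeff []      _       = 0#
  coeff (a ∷ p) zero    = a
  coeff (a ∷ p) (suc n) = coeff p n

  _≈ₚ_ : Poly → Poly → Set ℓ
  p ≈ₚ q = ∀ n → coeff p n ≈ coeff q n

  _+ₚ_ : Poly → Poly → Poly
  []      +ₚ q       = q
  (a ∷ p) +ₚ []      = a ∷ p
  (a ∷ p) +ₚ (b ∷ q) = (a + b) ∷ (p +ₚ q)

  infixr 7 _·_
  _·_ : Carrier → Poly → Poly
  a · p = map (a *_) p

  _*ₚ_ : Poly → Poly → Poly
  []      *ₚ q = []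
  (a ∷ p) *ₚ q = (a · q) +ₚ (0# ∷ (p *ₚ q))

  polyRing : RawRing c ℓ
  polyRing = record
    { Carrier = Poly
    ; _≈_     = _≈ₚ_
    ; _+_     = _+ₚ_
    ; _*_     = _*ₚ_
    ; -_      = map (-_)
    ; 0#      = []
    ; 1#      = 1# ∷ []
    }

module PowerSeries {c ℓ} (R : RawRing c ℓ) where
  open RawRing R
  open RawMonoidDefs +-rawMonoid using (sum)

  -- f n is the coefficient of zⁿ.
  Series : Set c
  Series = ℕ → Carrier

  seriesRing : RawRing c ℓ
  seriesRing = record
    { Carrier = Series
    ; _≈_     = λ f g → ∀ n → f n ≈ g n
    ; _+_     = λ f g n → f n + g n
    ; _*_     = λ f g n → sum {suc n} (λ i → f (toℕ i) * g (n ∸ toℕ i))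
    ; -_      = λ f n → - f n
    ; 0#      = λ _ → 0#
    ; 1#      = λ { zero → 1# ; (suc _) → 0# }
    }

module Determinant {c ℓ} (R : RawRing c ℓ) where
  open RawRing R
  open RawSemiringDefs rawSemiring using (sum; _^_)

  Matrix : ℕ → Set c
  Matrix n = Fin n → Fin n → Carrier

  -- Laplace expansion along the first row.
  det : ∀ {n} → Matrix n → Carrier
  det {zero}  M = 1#
  det {suc n} M = sum λ j →
    (- 1#) ^ toℕ j * (M zero j * det (λ i k → M (suc i) (punchIn j k)))

-- f = 1 / g
IsReciprocal : ∀ {c ℓ} (R : RawRing c ℓ) (f g : RawRing.Carrier R) → Set ℓ
IsReciprocal R f g = (f * g ≈ 1#) × (g * f ≈ 1#)
  where open RawRing R

-- The numbers form a field.  Constructively, "non-zero" is apartness from 0.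
module Numbers {c ℓ₁ ℓ₂} (𝔽 : HeytingField c ℓ₁ ℓ₂) where
  open HeytingField 𝔽

  numberRing : RawRing c ℓ₁
  numberRing = CommutativeRing.rawRing
    (HeytingCommutativeRing.commutativeRing heytingCommutativeRing)

  open Polynomial numberRing public using (Poly; _·_; polyRing)
  open PowerSeries polyRing public using (Series; seriesRing)
  open Determinant polyRing public using (Matrix; det)

  -- #⇒invertible y#0 supplies an inverse of y - 0#, which is y up to _≈_.
  infixl 7 _/_⟨_⟩
  _/_⟨_⟩ : (x y : Carrier) → y # 0# → Carrier
  x / y ⟨ y#0 ⟩ = x * proj₁ (#⇒invertible y#0)

  module Hessenberg
    (ρ : ℕ → Carrier) (ρ#0 : ∀ n → ρ n # 0#) (K : ℕ → Poly) where

    -- Indices i and j are 1-based, so the truncated subtractions below are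
    -- exact wherever they occur.
    entry : (i j : ℕ) → Poly
    entry i j =
      if j ≤ᵇ i then
        (ρ i / (ρ (j ∸ 1) * ρ (i ∸ j ℕ.+ 1))
             ⟨ x#0y#0→xy#0 heytingCommutativeRing
                 (ρ#0 (j ∸ 1)) (ρ#0 (i ∸ j ℕ.+ 1)) ⟩)
          · K (i ∸ j)
      else if j ≡ᵇ i ℕ.+ 1 then P.- P.1#
      else P.0#
      where module P = RawRing polyRing

    H : (n : ℕ) → Matrix n
    H n i j = entry (suc (toℕ i)) (suc (toℕ j))

    F : ℕ → Poly
    F n = det (H n)

    F-series : Series
    F-series zero    = RawRing.1# polyRing
    F-series (suc n) = (1# / ρ (suc n) ⟨ ρ#0 (suc n) ⟩) · F (suc n)

    K-series : Series
    K-series zero    = RawRing.0# polyRing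
    K-series (suc m) = (1# / ρ (suc m) ⟨ ρ#0 (suc m) ⟩) · K m

-- Up to the diagonal scaling h_ij = ρ_i ρ_{j-1}⁻¹ t_{i-j}, the matrix is Toeplitz,
-- with t_m = K_m / ρ_{m+1} and t_{-1} = -1; the scaling factors telescope to
-- ρ_n / ρ_0 in the determinant, so F_n / ρ_n = T_n := det (t_{i-j}).  Expanding
-- along the first column gives T_{n+1} = Σ_i t_i T_{n-i}, that is, T = 1 + K T.
module Submission where

open import Defs
open import Algebra.Apartness.Bundles using (HeytingCommutativeRing; HeytingField)
open import Algebra.Apartness.Properties.HeytingCommutativeRing using (x#0y#0→xy#0; x-0≈x)
open import Algebra.Bundles using (CommutativeMonoid; CommutativeRing)
open import Algebra.Bundles.Raw using (RawRing)
import Algebra.Definitions.RawSemiring as RawSemiringDefinitions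
import Algebra.Construct.Pointwise as Pointwise
open import Algebra.Morphism.Structures using (IsRingMonomorphism)
import Algebra.Morphism.RingMonomorphism as RingMonomorphism
import Algebra.Properties.CommutativeMonoid.Sum as CommutativeMonoidSum
import Algebra.Properties.CommutativeSemigroup as CommutativeSemigroupProperties
import Algebra.Properties.Ring as RingProperties
import Algebra.Properties.Semiring.Sum as SemiringSum
import Algebra.Solver.CommutativeMonoid as CommutativeMonoidSolver
open import Data.Bool.Base using (true; false; if_then_else_; T)
open import Data.Fin.Base using (Fin; zero; suc; toℕ; punchIn)
open import Data.List.Base using ([]; _∷_; map)
open import Data.Nat.Base as ℕ using (ℕ; zero; suc; _∸_; _<ᵇ_; _≡ᵇ_)
import Data.Nat.Properties as ℕₚ
open import Data.Product.Base using (_,_; proj₁; proj₂)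
open import Data.Unit.Base using (tt)
open import Function.Base using (_∘_)
open import Relation.Binary.PropositionalEquality as ≡ using ()
import Relation.Binary.Reasoning.Setoid as ≈-Reasoning

-- Power series over a commutative ring form a commutative ring.

module SeriesProperties {c ℓ} (R : CommutativeRing c ℓ) where
  open CommutativeRing R hiding (zero)
  open PowerSeries rawRing
  open RawRing seriesRing using () renaming (_*_ to _⊛_; 1# to 1ₛ; _≈_ to _≈ₛ_)
  open CommutativeSemigroupProperties
    (CommutativeMonoid.commutativeSemigroup +-commutativeMonoid) using (interchange)
  open ≈-Reasoning setoid

  -- `(f ⊛ g) (suc n)` unfolds to `f 0 * g (suc n) + ((f ∘ suc) ⊛ g) n`, so many of the laws below
  -- go by induction on the index with `f` replaced by its shift.
  ⊛-cong : ∀ {f f′ g g′} → f ≈ₛ f′ → g ≈ₛ g′ → (f ⊛ g) ≈ₛ (f′ ⊛ g′)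
  ⊛-cong p q zero    = +-congʳ (*-cong (p 0) (q 0))
  ⊛-cong p q (suc n) = +-cong (*-cong (p 0) (q (suc n))) (⊛-cong (p ∘ suc) q n)

  ⊛-zeroˡ : ∀ g n → ((λ _ → 0#) ⊛ g) n ≈ 0#
  ⊛-zeroˡ g zero    = trans (+-identityʳ _) (zeroˡ _)
  ⊛-zeroˡ g (suc n) = trans (+-cong (zeroˡ _) (⊛-zeroˡ g n)) (+-identityʳ _)

  ⊛-identityˡ : ∀ g → (1ₛ ⊛ g) ≈ₛ g
  ⊛-identityˡ g zero    = trans (+-identityʳ _) (*-identityˡ _)
  ⊛-identityˡ g (suc n) = trans (+-cong (*-identityˡ _) (⊛-zeroˡ g n)) (+-identityʳ _)

  -- Splits off the last term of the sum instead of the first, which is what the reversal of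
  -- summation in `⊛-comm` calls for.
  ⊛-suc : ∀ f g n → (f ⊛ g) (suc n) ≈ (f ⊛ (g ∘ suc)) n + f (suc n) * g 0
  ⊛-suc f g zero = trans (+-congˡ (+-identityʳ _)) (+-congʳ (sym (+-identityʳ _)))
  ⊛-suc f g (suc n) =
    trans (+-congˡ (⊛-suc (f ∘ suc) g n)) (sym (+-assoc _ _ _))

  ⊛-comm : ∀ f g → (f ⊛ g) ≈ₛ (g ⊛ f)
  ⊛-comm f g zero    = +-congʳ (*-comm _ _)
  ⊛-comm f g (suc n) = begin
    f 0 * g (suc n) + ((f ∘ suc) ⊛ g) n ≈⟨ +-cong (*-comm _ _) (⊛-comm (f ∘ suc) g n) ⟩
    g (suc n) * f 0 + (g ⊛ (f ∘ suc)) n ≈⟨ +-comm _ _ ⟩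
    (g ⊛ (f ∘ suc)) n + g (suc n) * f 0 ≈⟨ ⊛-suc g f n ⟨
    (g ⊛ f) (suc n)                     ∎

  ⊛-distribʳ : ∀ h f g n → ((λ m → f m + g m) ⊛ h) n ≈ (f ⊛ h) n + (g ⊛ h) n
  ⊛-distribʳ h f g zero    = begin
    (f 0 + g 0) * h 0 + 0#                ≈⟨ +-cong (distribʳ _ _ _) (sym (+-identityʳ _)) ⟩
    (f 0 * h 0 + g 0 * h 0) + (0# + 0#)   ≈⟨ interchange _ _ _ _ ⟩
    (f 0 * h 0 + 0#) + (g 0 * h 0 + 0#)   ∎
  ⊛-distribʳ h f g (suc n) =
    trans (+-cong (distribʳ _ _ _) (⊛-distribʳ h (f ∘ suc) (g ∘ suc) n)) (interchange _ _ _ _)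

  ⊛-distribˡ : ∀ h f g n → (h ⊛ (λ m → f m + g m)) n ≈ (h ⊛ f) n + (h ⊛ g) n
  ⊛-distribˡ h f g n = begin
    (h ⊛ (λ m → f m + g m)) n   ≈⟨ ⊛-comm h (λ m → f m + g m) n ⟩
    ((λ m → f m + g m) ⊛ h) n   ≈⟨ ⊛-distribʳ h f g n ⟩
    (f ⊛ h) n + (g ⊛ h) n       ≈⟨ +-cong (⊛-comm f h n) (⊛-comm g h n) ⟩
    (h ⊛ f) n + (h ⊛ g) n       ∎

  ⊛-scaleˡ : ∀ x f g n → ((λ m → x * f m) ⊛ g) n ≈ x * (f ⊛ g) n
  ⊛-scaleˡ x f g zero    =
    trans (+-cong (*-assoc _ _ _) (sym (zeroʳ x))) (sym (distribˡ _ _ _))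
  ⊛-scaleˡ x f g (suc n) =
    trans (+-cong (*-assoc _ _ _) (⊛-scaleˡ x (f ∘ suc) g n)) (sym (distribˡ _ _ _))

  ⊛-assoc : ∀ f g h → ((f ⊛ g) ⊛ h) ≈ₛ (f ⊛ (g ⊛ h))
  ⊛-assoc f g h zero = +-congʳ (begin
    (f 0 * g 0 + 0#) * h 0   ≈⟨ *-congʳ (+-identityʳ _) ⟩
    f 0 * g 0 * h 0          ≈⟨ *-assoc _ _ _ ⟩
    f 0 * (g 0 * h 0)        ≈⟨ *-congˡ (+-identityʳ _) ⟨
    f 0 * (g 0 * h 0 + 0#)   ∎)
  -- The shift of `f ⊛ g` is a sum of two series, a multiple of `g ∘ suc` and `(f ∘ suc) ⊛ g`;
  -- distributing over it brings the induction hypothesis into reach.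
  ⊛-assoc f g h (suc n) = begin
    (f 0 * g 0 + 0#) * h (suc n) + (((f ⊛ g) ∘ suc) ⊛ h) n
      ≈⟨ +-cong (trans (*-congʳ (+-identityʳ _)) (*-assoc _ _ _))
                (⊛-distribʳ h (λ m → f 0 * g (suc m)) ((f ∘ suc) ⊛ g) n) ⟩
    f 0 * (g 0 * h (suc n)) + (((λ m → f 0 * g (suc m)) ⊛ h) n + (((f ∘ suc) ⊛ g) ⊛ h) n)
      ≈⟨ +-congˡ (+-cong (⊛-scaleˡ (f 0) (g ∘ suc) h n) (⊛-assoc (f ∘ suc) g h n)) ⟩
    f 0 * (g 0 * h (suc n)) + (f 0 * ((g ∘ suc) ⊛ h) n + ((f ∘ suc) ⊛ (g ⊛ h)) n)
      ≈⟨ +-assoc _ _ _ ⟨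
    f 0 * (g 0 * h (suc n)) + f 0 * ((g ∘ suc) ⊛ h) n + ((f ∘ suc) ⊛ (g ⊛ h)) n
      ≈⟨ +-congʳ (distribˡ _ _ _) ⟨
    f 0 * (g ⊛ h) (suc n) + ((f ∘ suc) ⊛ (g ⊛ h)) n
      ∎

  seriesCommutativeRing : CommutativeRing c ℓ
  seriesCommutativeRing = record
    { Carrier = RawRing.Carrier seriesRing
    ; _≈_ = RawRing._≈_ seriesRing
    ; _+_ = RawRing._+_ seriesRing
    ; _*_ = RawRing._*_ seriesRing
    ; -_  = RawRing.-_ seriesRing
    ; 0#  = RawRing.0# seriesRing
    ; 1#  = RawRing.1# seriesRing
    ; isCommutativeRing = record
      { isRing = record
        { +-isAbelianGroup = Pointwise.isAbelianGroup ℕ +-isAbelianGroup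
        ; *-cong     = ⊛-cong
        ; *-assoc    = ⊛-assoc
        ; *-identity = ⊛-identityˡ , λ f n → trans (⊛-comm f 1ₛ n) (⊛-identityˡ f n)
        ; distrib    = ⊛-distribˡ , ⊛-distribʳ
        }
      ; *-comm = ⊛-comm
      }
    }

-- Polynomials form a commutative ring, embedded in power series by their coefficients.

module PolynomialProperties {c ℓ} (R : CommutativeRing c ℓ) where
  open CommutativeRing R hiding (zero)
  open Polynomial rawRing
  open PowerSeries rawRing using (seriesRing)
  open RawRing seriesRing using () renaming (_*_ to _⊛_; 1# to 1ₛ)
  open SeriesProperties R using (⊛-zeroˡ; seriesCommutativeRing)
  open RingProperties ring using (-0#≈0#)

  coeff-+ : ∀ p q n → coeff (p +ₚ q) n ≈ coeff p n + coeff q n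
  coeff-+ []      q       n       = sym (+-identityˡ _)
  coeff-+ (a ∷ p) []      n       = sym (+-identityʳ _)
  coeff-+ (a ∷ p) (b ∷ q) zero    = refl
  coeff-+ (a ∷ p) (b ∷ q) (suc n) = coeff-+ p q n

  coeff-· : ∀ a p n → coeff (a · p) n ≈ a * coeff p n
  coeff-· a []      n       = sym (zeroʳ a)
  coeff-· a (b ∷ p) zero    = refl
  coeff-· a (b ∷ p) (suc n) = coeff-· a p n

  coeff-neg : ∀ p n → coeff (map (-_) p) n ≈ - coeff p n
  coeff-neg []      n       = sym -0#≈0#
  coeff-neg (a ∷ p) zero    = refl
  coeff-neg (a ∷ p) (suc n) = coeff-neg p n

  coeff-* : ∀ p q n → coeff (p *ₚ q) n ≈ (coeff p ⊛ coeff q) n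
  coeff-* []      q n       = sym (⊛-zeroˡ (coeff q) n)
  coeff-* (a ∷ p) q zero    =
    trans (coeff-+ (a · q) (0# ∷ (p *ₚ q)) zero) (+-congʳ (coeff-· a q zero))
  coeff-* (a ∷ p) q (suc n) =
    trans (coeff-+ (a · q) (0# ∷ (p *ₚ q)) (suc n)) (+-cong (coeff-· a q (suc n)) (coeff-* p q n))

  coeff-1 : ∀ n → coeff (1# ∷ []) n ≈ 1ₛ n
  coeff-1 zero    = refl
  coeff-1 (suc n) = refl

  -- Equality of polynomials is by definition equality of coefficient series, so `coeff` preserves
  -- and reflects it trivially; the ring laws for lists are then pulled back from series.
  coeff-isRingMonomorphism : IsRingMonomorphism polyRing seriesRing coeff
  coeff-isRingMonomorphism = record
    { isRingHomomorphism = record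
      { isSemiringHomomorphism = record
        { isNearSemiringHomomorphism = record
          { +-isMonoidHomomorphism = record
            { isMagmaHomomorphism = record
              { isRelHomomorphism = record { cong = λ p≈q → p≈q }
              ; homo = coeff-+
              }
            ; ε-homo = λ _ → refl
            }
          ; *-homo = coeff-*
          }
        ; 1#-homo = coeff-1
        }
      ; -‿homo = coeff-neg
      }
    ; injective = λ p≈q → p≈q
    }

  polyCommutativeRing : CommutativeRing c ℓ
  polyCommutativeRing = record
    { Carrier = RawRing.Carrier polyRing
    ; _≈_ = RawRing._≈_ polyRing
    ; _+_ = RawRing._+_ polyRing
    ; _*_ = RawRing._*_ polyRing
    ; -_  = RawRing.-_ polyRing
    ; 0#  = RawRing.0# polyRing
    ; 1#  = RawRing.1# polyRing
    ; isCommutativeRing = RingMonomorphism.isCommutativeRing coeff-isRingMonomorphism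
        (CommutativeRing.isCommutativeRing seriesCommutativeRing)
    }

  -- Scalars enter as constant polynomials, so that scaling by numbers becomes ring multiplication
  -- and determinant lemmas over a commutative ring apply.
  const : Carrier → Poly
  const a = a ∷ []

  coeff-const-* : ∀ a p n → coeff (const a *ₚ p) n ≈ a * coeff p n
  coeff-const-* a p n =
    -- The empty tail of `const a` contributes a summand `0# ∷ []`, whose coefficients all vanish.
    trans (coeff-+ (a · p) (0# ∷ []) n)
      (trans (+-cong (coeff-· a p n) (coeff-0∷[] n)) (+-identityʳ _))
    where
    coeff-0∷[] : ∀ n → coeff (0# ∷ []) n ≈ 0#
    coeff-0∷[] zero    = refl
    coeff-0∷[] (suc n) = refl

-- Determinants: diagonal scaling and the Toeplitz recurrence.

module DeterminantProperties {c ℓ} (R : CommutativeRing c ℓ) where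
  open CommutativeRing R hiding (zero)
  open Determinant rawRing
  open PowerSeries rawRing using (Series; seriesRing)
  open RawRing seriesRing using () renaming (_*_ to _⊛_; _≈_ to _≈ₛ_; _+_ to _+ₛ_; 1# to 1ₛ)
  open RawSemiringDefinitions (RawRing.rawSemiring rawRing) using (_^_)
  open SemiringSum semiring using (sum; sum-cong-≋; sum-replicate-zero; *-distribˡ-sum)
  open CommutativeMonoidSum *-commutativeMonoid using ()
    renaming (sum to product; sum-remove to product-remove)
  open CommutativeSemigroupProperties
    (CommutativeMonoid.commutativeSemigroup *-commutativeMonoid) using (interchange)
  open RingProperties ring using (-1*x≈-x; -‿involutive)
  open ≈-Reasoning setoid

  det-cong : ∀ {n} {M N : Matrix n} → (∀ i j → M i j ≈ N i j) → det M ≈ det N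
  det-cong {zero}  M≈N = refl
  det-cong {suc n} M≈N = sum-cong-≋ λ j →
    *-congˡ {(- 1#) ^ toℕ j} (*-cong (M≈N zero j) (det-cong λ i k → M≈N (suc i) (punchIn j k)))

  -- In the expansion along the first row, the minor of column `j` lacks exactly the factor `v j`,
  -- and the entry in the first row supplies it.
  det-scale : ∀ {n} (u v : Fin n → Carrier) (M : Matrix n) →
    det (λ i j → u i * (v j * M i j)) ≈ product u * (product v * det M)
  det-scale {zero}  u v M = sym (trans (*-identityˡ _) (*-identityˡ _))
  det-scale {suc n} u v M = begin
    det (λ i j → u i * (v j * M i j))
      ≈⟨ sum-cong-≋ scale-term ⟩
    sum (λ j → product u * (product v * term j))
      ≈⟨ *-distribˡ-sum (product u) (λ j → product v * term j) ⟨
    product u * sum (λ j → product v * term j)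
      ≈⟨ *-congˡ (*-distribˡ-sum (product v) term) ⟨
    product u * (product v * sum term)
      ∎
    where
    sign : Fin (suc n) → Carrier
    sign j = (- 1#) ^ toℕ j

    minor : Fin (suc n) → Matrix n
    minor j i k = M (suc i) (punchIn j k)

    term : Fin (suc n) → Carrier
    term j = sign j * (M zero j * det (minor j))

    rearrange : ∀ s a b m p q d →
      s * ((a * (b * m)) * (p * (q * d))) ≈ (a * p) * ((b * q) * (s * (m * d)))
    rearrange = solve 7 (λ s a b m p q d →
      s ⊕ ((a ⊕ (b ⊕ m)) ⊕ (p ⊕ (q ⊕ d))) ⊜ (a ⊕ p) ⊕ ((b ⊕ q) ⊕ (s ⊕ (m ⊕ d)))) refl
      where open CommutativeMonoidSolver *-commutativeMonoid

    scale-term : ∀ j →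
      sign j * ((u zero * (v j * M zero j)) *
        det (λ i k → u (suc i) * (v (punchIn j k) * minor j i k)))
      ≈ product u * (product v * term j)
    scale-term j = begin
      _ ≈⟨ *-congˡ (*-congˡ (det-scale (u ∘ suc) (v ∘ punchIn j) (minor j))) ⟩
      _ ≈⟨ rearrange _ _ _ _ _ _ _ ⟩
      product u * ((v j * product (v ∘ punchIn j)) * term j)
        ≈⟨ *-congˡ (*-congʳ (product-remove {i = j} v)) ⟨
      product u * (product v * term j) ∎

  -- Rows carry `r 1`, ..., `r n` and columns `s 0`, ..., `s (n - 1)`; each `s m` with `0 < m < n`
  -- cancels `r m`, leaving the two ends.
  product-telescope : ∀ n (r s : ℕ → Carrier) → (∀ m → r m * s m ≈ 1#) →
    product {n} (λ i → r (suc (toℕ i))) * product {n} (s ∘ toℕ) ≈ r n * s 0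
  product-telescope zero    r s rs≈1 = trans (*-identityˡ _) (sym (rs≈1 0))
  product-telescope (suc n) r s rs≈1 = begin
    (r 1 * product {n} (λ i → r (suc (suc (toℕ i))))) * (s 0 * product {n} (s ∘ suc ∘ toℕ))
      ≈⟨ interchange (r 1) _ (s 0) _ ⟩
    (r 1 * s 0) * (product {n} (λ i → r (suc (suc (toℕ i)))) * product {n} (s ∘ suc ∘ toℕ))
      -- The shifted sequences leave `r (suc n) * s 1`, and this `s 1` then cancels against `r 1`.
      ≈⟨ *-congˡ (product-telescope n (r ∘ suc) (s ∘ suc) (rs≈1 ∘ suc)) ⟩
    (r 1 * s 0) * (r (suc n) * s 1)
      ≈⟨ swap (r 1) (s 0) (r (suc n)) (s 1) ⟩
    (r 1 * s 1) * (r (suc n) * s 0)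
      ≈⟨ *-congʳ (rs≈1 1) ⟩
    1# * (r (suc n) * s 0)
      ≈⟨ *-identityˡ _ ⟩
    r (suc n) * s 0 ∎
    where
    open CommutativeMonoidSolver *-commutativeMonoid
    swap : ∀ a b c d → (a * b) * (c * d) ≈ (a * d) * (c * b)
    swap = solve 4 (λ a b c d → (a ⊕ b) ⊕ (c ⊕ d) ⊜ (a ⊕ d) ⊕ (c ⊕ b)) refl

  -- The extra factor `s n` cancels the surviving `r n`. With `r` the constants `ρ` and `s` their
  -- reciprocals, this is the passage from `F n / ρ n` to a Toeplitz determinant.
  det-telescope : ∀ n (r s : ℕ → Carrier) → (∀ m → r m * s m ≈ 1#) → (M : Matrix n) →
    s n * det (λ i j → r (suc (toℕ i)) * (s (toℕ j) * M i j)) ≈ s 0 * det M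
  det-telescope n r s rs≈1 M = begin
    s n * det (λ i j → r (suc (toℕ i)) * (s (toℕ j) * M i j))
      ≈⟨ *-congˡ (det-scale (λ i → r (suc (toℕ i))) (s ∘ toℕ) M) ⟩
    s n * (product {n} (λ i → r (suc (toℕ i))) * (product {n} (s ∘ toℕ) * det M))
      ≈⟨ *-congˡ (*-assoc _ _ _) ⟨
    s n * ((product {n} (λ i → r (suc (toℕ i))) * product {n} (s ∘ toℕ)) * det M)
      ≈⟨ *-congˡ (*-congʳ (product-telescope n r s rs≈1)) ⟩
    s n * ((r n * s 0) * det M)
      ≈⟨ regroup (s n) (r n) (s 0) (det M) ⟩
    (r n * s n) * (s 0 * det M)
      ≈⟨ *-congʳ (rs≈1 n) ⟩
    1# * (s 0 * det M)
      ≈⟨ *-identityˡ _ ⟩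
    s 0 * det M ∎
    where
    open CommutativeMonoidSolver *-commutativeMonoid
    regroup : ∀ a b c d → a * ((b * c) * d) ≈ (b * a) * (c * d)
    regroup = solve 4 (λ a b c d → a ⊕ ((b ⊕ c) ⊕ d) ⊜ (b ⊕ a) ⊕ (c ⊕ d)) refl

  leading : (ℕ → ℕ → Carrier) → (n : ℕ) → Matrix n
  leading M n i j = M (toℕ i) (toℕ j)

  -- The Booleans are written so that toeplitz a (suc i) (suc j) and
  -- toeplitz a i j are definitionally equal.
  toeplitz : (ℕ → Carrier) → ℕ → ℕ → Carrier
  toeplitz a i j =
    if j <ᵇ suc i then a (i ∸ j)
    else if j ≡ᵇ i ℕ.+ 1 then - 1#
    else 0#

  toeplitzDet : (ℕ → Carrier) → ℕ → Carrier
  toeplitzDet a n = det (leading (toeplitz a) n)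

  -- Deleting the first row and the second column of a bordered matrix leaves
  -- one of the same shape, which makes the expansion below an induction.
  bordered : (c a : ℕ → Carrier) → ℕ → ℕ → Carrier
  bordered c a i zero    = c i
  bordered c a i (suc j) = toeplitz a i (suc j)

  -- In the first row only `c 0` and the superdiagonal `- 1#` can be non-zero. Deleting column 0
  -- leaves a Toeplitz matrix, deleting column 1 the same shape with border `c ∘ suc`; the induction
  -- thus carries out an expansion along the first column by first-row expansions.
  det-bordered : ∀ n c a → det (leading (bordered c a) (suc n)) ≈ (c ⊛ toeplitzDet a) n
  det-bordered zero    c a = +-congʳ (*-identityˡ _)
  det-bordered (suc n) c a = begin
    1# * (c 0 * toeplitzDet a (suc n)) +
      ((- 1# * 1#) * (- 1# * det minor) + sum {n} rest)
      -- The sign of column 1 cancels against the entry `- 1#`; later columns meet the first row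
      -- above the superdiagonal and contribute nothing.
      ≈⟨ +-cong (*-identityˡ _) (+-cong signs rest≈0) ⟩
    c 0 * toeplitzDet a (suc n) + (det minor + 0#)
      ≈⟨ +-congˡ (+-identityʳ _) ⟩
    c 0 * toeplitzDet a (suc n) + det minor
      ≈⟨ +-congˡ (det-cong {suc n} minor≈) ⟩
    c 0 * toeplitzDet a (suc n) + det (leading (bordered (c ∘ suc) a) (suc n))
      ≈⟨ +-congˡ (det-bordered n (c ∘ suc) a) ⟩
    (c ⊛ toeplitzDet a) (suc n) ∎
    where
    minor : Matrix (suc n)
    minor i k = leading (bordered c a) (suc (suc n)) (suc i) (punchIn (suc zero) k)

    minor≈ : ∀ i k → minor i k ≈ leading (bordered (c ∘ suc) a) (suc n) i k
    minor≈ i zero    = refl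
    minor≈ i (suc k) = refl

    rest : Fin n → Carrier
    rest j = (- 1#) ^ suc (suc (toℕ j)) *
      (0# * det (λ i k → leading (bordered c a) (suc (suc n)) (suc i) (punchIn (suc (suc j)) k)))

    rest-term≈0 : ∀ j → rest j ≈ 0#
    rest-term≈0 j = trans (*-congˡ {(- 1#) ^ suc (suc (toℕ j))} (zeroˡ _)) (zeroʳ _)

    rest≈0 : sum rest ≈ 0#
    rest≈0 = trans (sum-cong-≋ {n} rest-term≈0) (sum-replicate-zero n)

    signs : (- 1# * 1#) * (- 1# * det minor) ≈ det minor
    signs = begin
      (- 1# * 1#) * (- 1# * det minor)   ≈⟨ *-cong (*-identityʳ _) (-1*x≈-x _) ⟩
      - 1# * - det minor                 ≈⟨ -1*x≈-x _ ⟩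
      - - det minor                      ≈⟨ -‿involutive _ ⟩
      det minor                          ∎

  -- A Toeplitz matrix is bordered by its own first column, so `c` is taken to be `a`.
  toeplitzDet-suc : ∀ a n → toeplitzDet a (suc n) ≈ (a ⊛ toeplitzDet a) n
  toeplitzDet-suc a n = trans (det-cong {suc n} toeplitz≈bordered) (det-bordered n a a)
    where
    toeplitz≈bordered : ∀ i j →
      leading (toeplitz a) (suc n) i j ≈ leading (bordered a a) (suc n) i j
    toeplitz≈bordered i zero    = refl
    toeplitz≈bordered i (suc j) = refl

  -- The recurrence read as an equation of power series. As `k 0` vanishes, the first term of the
  -- convolution drops, and the rest is the convolution of `k ∘ suc` one index lower.
  toeplitzDet-fixpoint : ∀ k → k 0 ≈ 0# →
    toeplitzDet (k ∘ suc) ≈ₛ (1ₛ +ₛ (k ⊛ toeplitzDet (k ∘ suc)))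
  toeplitzDet-fixpoint k k₀≈0 zero = sym (begin
    1# + (k 0 * 1# + 0#)   ≈⟨ +-congˡ (trans (+-identityʳ _) (*-identityʳ _)) ⟩
    1# + k 0               ≈⟨ +-congˡ k₀≈0 ⟩
    1# + 0#                ≈⟨ +-identityʳ _ ⟩
    1#                     ∎)
  toeplitzDet-fixpoint k k₀≈0 (suc n) = sym (begin
    0# + (k 0 * t (suc n) + ((k ∘ suc) ⊛ t) n) ≈⟨ +-identityˡ _ ⟩
    k 0 * t (suc n) + ((k ∘ suc) ⊛ t) n        ≈⟨ +-congʳ (trans (*-congʳ k₀≈0) (zeroˡ _)) ⟩
    0# + ((k ∘ suc) ⊛ t) n                     ≈⟨ +-identityˡ _ ⟩
    ((k ∘ suc) ⊛ t) n                          ≈⟨ toeplitzDet-suc (k ∘ suc) n ⟨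
    t (suc n)                                  ∎)
    where
    t : Series
    t = toeplitzDet (k ∘ suc)

-- Passing from a fixed-point equation to a reciprocal.

fixpoint⇒reciprocal : ∀ {c ℓ} (R : CommutativeRing c ℓ) →
  let open CommutativeRing R in
  ∀ f k → f ≈ 1# + k * f → IsReciprocal rawRing f (1# + - k)
fixpoint⇒reciprocal R f k f≈1+kf = trans (*-comm _ _) inverse , inverse
  where
  open CommutativeRing R hiding (zero)
  open RingProperties ring using (-‿distribˡ-*)
  open ≈-Reasoning setoid
  inverse : (1# + - k) * f ≈ 1#
  inverse = begin
    (1# + - k) * f             ≈⟨ distribʳ _ _ _ ⟩
    1# * f + - k * f           ≈⟨ +-cong (*-identityˡ _) (sym (-‿distribˡ-* _ _)) ⟩
    f + - (k * f)              ≈⟨ +-congʳ f≈1+kf ⟩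
    (1# + k * f) + - (k * f)   ≈⟨ +-assoc _ _ _ ⟩
    1# + (k * f + - (k * f))   ≈⟨ +-congˡ (-‿inverseʳ _) ⟩
    1# + 0#                    ≈⟨ +-identityʳ _ ⟩
    1#                         ∎

-- Reciprocals in a Heyting field.

module FieldProperties {c ℓ₁ ℓ₂} (𝔽 : HeytingField c ℓ₁ ℓ₂) where
  open HeytingField 𝔽 hiding (zero)
  private
    commutativeRing : CommutativeRing c ℓ₁
    commutativeRing = HeytingCommutativeRing.commutativeRing heytingCommutativeRing
  open CommutativeRing commutativeRing using (*-commutativeMonoid)
  open CommutativeSemigroupProperties
    (CommutativeMonoid.commutativeSemigroup *-commutativeMonoid) using (interchange)
  open ≈-Reasoning setoid

  recip : ∀ {x} → x # 0# → Carrier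
  recip x#0 = proj₁ (#⇒invertible x#0)

  *-recip : ∀ {x} (x#0 : x # 0#) → x * recip x#0 ≈ 1#
  *-recip {x} x#0 = trans (*-congʳ (sym (x-0≈x heytingCommutativeRing x)))
    (proj₂ (proj₂ (#⇒invertible x#0)))

  inverse-unique : ∀ {x y z} → x * y ≈ 1# → x * z ≈ 1# → y ≈ z
  inverse-unique {x} {y} {z} xy≈1 xz≈1 = begin
    y             ≈⟨ *-identityʳ _ ⟨
    y * 1#        ≈⟨ *-congˡ xz≈1 ⟨
    y * (x * z)   ≈⟨ *-assoc _ _ _ ⟨
    (y * x) * z   ≈⟨ *-congʳ (trans (*-comm _ _) xy≈1) ⟩
    1# * z        ≈⟨ *-identityˡ _ ⟩
    z             ∎

  -- `recip` depends on an apartness proof, and equal numbers may come with different ones;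
  -- uniqueness of inverses identifies the results.
  recip-cong : ∀ {x y} (x#0 : x # 0#) (y#0 : y # 0#) → x ≈ y → recip x#0 ≈ recip y#0
  recip-cong x#0 y#0 x≈y =
    inverse-unique (*-recip x#0) (trans (*-congʳ x≈y) (*-recip y#0))

  recip-* : ∀ {x y} (x#0 : x # 0#) (y#0 : y # 0#) (xy#0 : x * y # 0#) →
    recip xy#0 ≈ recip x#0 * recip y#0
  recip-* {x} {y} x#0 y#0 xy#0 = inverse-unique (*-recip xy#0) (begin
    (x * y) * (recip x#0 * recip y#0)   ≈⟨ interchange x y (recip x#0) (recip y#0) ⟩
    (x * recip x#0) * (y * recip y#0)   ≈⟨ *-cong (*-recip x#0) (*-recip y#0) ⟩
    1# * 1#                             ≈⟨ *-identityˡ _ ⟩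
    1#                                  ∎)

-- Hessenberg determinants as scaled Toeplitz determinants.

module HessenbergProperties {c ℓ₁ ℓ₂} (𝔽 : HeytingField c ℓ₁ ℓ₂)
  (ρ : ℕ → HeytingField.Carrier 𝔽)
  (ρ#0 : ∀ n → HeytingField._#_ 𝔽 (ρ n) (HeytingField.0# 𝔽))
  (K : ℕ → Numbers.Poly 𝔽) where

  open HeytingField 𝔽 hiding (zero)
  open Numbers 𝔽
  open Hessenberg ρ ρ#0 K
  open FieldProperties 𝔽
  open PolynomialProperties (HeytingCommutativeRing.commutativeRing heytingCommutativeRing)
  open Polynomial numberRing using (coeff; _≈ₚ_; _*ₚ_)
  open DeterminantProperties polyCommutativeRing
  private module P = CommutativeRing polyCommutativeRing

  σ : ℕ → Carrier
  σ n = recip (ρ#0 n)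

  -- Separates a row factor and a column factor from the scalar that multiplies `K (i ∸ j)` in
  -- `K-series`. Both sides use the same truncated difference, so `j` may exceed `i`.
  coefficient-factors : ∀ i j →
    ρ (suc i) / (ρ j * ρ (i ∸ j ℕ.+ 1))
        ⟨ x#0y#0→xy#0 heytingCommutativeRing (ρ#0 j) (ρ#0 (i ∸ j ℕ.+ 1)) ⟩
    ≈ ρ (suc i) * (σ j * (1# / ρ (suc (i ∸ j)) ⟨ ρ#0 (suc (i ∸ j)) ⟩))
  coefficient-factors i j = *-congˡ (trans
    (recip-* (ρ#0 j) (ρ#0 (i ∸ j ℕ.+ 1)) _)
    (*-congˡ (trans
      (recip-cong _ _ (reflexive (≡.cong ρ (ℕₚ.+-comm (i ∸ j) 1))))
      (sym (*-identityˡ _)))))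

  coeff-const²-* : ∀ r s p n → coeff (const r *ₚ (const s *ₚ p)) n ≈ r * (s * coeff p n)
  coeff-const²-* r s p n =
    trans (coeff-const-* r (const s *ₚ p) n) (*-congˡ (coeff-const-* s p n))

  -- Stated for arbitrary Booleans so that pattern matching separates the three kinds of entries. A
  -- zero entry absorbs any factors, whereas for the entry -1 the two factors must multiply to 1.
  if-scale : ∀ b b′ {x y r s} (p : Poly) → x ≈ r * (s * y) → (T b′ → r * s ≈ 1#) →
    (if b then x · p else if b′ then P.- P.1# else P.0#)
    ≈ₚ (const r *ₚ (const s *ₚ (if b then y · p else if b′ then P.- P.1# else P.0#)))
  if-scale true b′ {x} {y} {r} {s} p x≈rsy _ n = begin
    coeff (x · p) n               ≈⟨ coeff-· x p n ⟩
    x * coeff p n                 ≈⟨ *-congʳ x≈rsy ⟩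
    (r * (s * y)) * coeff p n     ≈⟨ *-assoc _ _ _ ⟩
    r * ((s * y) * coeff p n)     ≈⟨ *-congˡ (*-assoc _ _ _) ⟩
    r * (s * (y * coeff p n))     ≈⟨ *-congˡ (*-congˡ (coeff-· y p n)) ⟨
    r * (s * coeff (y · p) n)     ≈⟨ coeff-const²-* r s (y · p) n ⟨
    coeff (const r *ₚ (const s *ₚ (y · p))) n ∎
    where open ≈-Reasoning setoid
  if-scale false true {r = r} {s} p _ rs≈1 n = begin
    z               ≈⟨ *-identityˡ _ ⟨
    1# * z          ≈⟨ *-congʳ (rs≈1 tt) ⟨
    (r * s) * z     ≈⟨ *-assoc _ _ _ ⟩
    r * (s * z)     ≈⟨ coeff-const²-* r s (P.- P.1#) n ⟨
    coeff (const r *ₚ (const s *ₚ (P.- P.1#))) n ∎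
    where
    open ≈-Reasoning setoid
    z : Carrier
    z = coeff (P.- P.1#) n
  if-scale false false {r = r} {s} p _ _ n =
    sym (trans (coeff-const²-* r s [] n) (trans (*-congˡ (zeroʳ _)) (zeroʳ _)))

  entry-factors : ∀ i j → entry (suc i) (suc j) ≈ₚ
    (const (ρ (suc i)) *ₚ (const (σ j) *ₚ toeplitz (K-series ∘ suc) i j))
  entry-factors i j = if-scale (j <ᵇ suc i) (j ≡ᵇ i ℕ.+ 1) (K (i ∸ j))
    (coefficient-factors i j) superdiagonal
    where
    -- On the superdiagonal `j` is `suc i`, so the row factor `ρ (suc i)` meets its own reciprocal.
    superdiagonal : T (j ≡ᵇ i ℕ.+ 1) → ρ (suc i) * σ j ≈ 1#
    superdiagonal t with ≡.trans (ℕₚ.≡ᵇ⇒≡ j (i ℕ.+ 1) t) (ℕₚ.+-comm i 1)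
    ... | ≡.refl = *-recip (ρ#0 (suc i))

  const-inverse : ∀ m → (const (ρ m) *ₚ const (σ m)) ≈ₚ P.1#
  const-inverse m zero    =
    trans (coeff-const-* (ρ m) (const (σ m)) zero) (*-recip (ρ#0 m))
  const-inverse m (suc n) =
    trans (coeff-const-* (ρ m) (const (σ m)) (suc n)) (zeroʳ _)

  -- The factor `σ (suc n)` in front of the determinant cancels the last row factor, and the
  -- remaining `σ 0` is 1 because `ρ 0` is.
  F-series≈toeplitzDet : ρ 0 ≈ 1# → ∀ n → F-series n ≈ₚ toeplitzDet (K-series ∘ suc) n
  F-series≈toeplitzDet ρ₀≈1 zero    = P.refl {P.1#}
  F-series≈toeplitzDet ρ₀≈1 (suc n) = begin
    (1# * σ (suc n)) · F (suc n)
      ≈⟨ scale≈const ⟩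
    const (σ (suc n)) *ₚ F (suc n)
      ≈⟨ P.*-congˡ {const (σ (suc n))} {F (suc n)} {det scaled}
           (det-cong {suc n} {H (suc n)} {scaled} λ i j → entry-factors (toℕ i) (toℕ j)) ⟩
    const (σ (suc n)) *ₚ det scaled
      ≈⟨ det-telescope (suc n) (const ∘ ρ) (const ∘ σ) const-inverse
           (leading (toeplitz (K-series ∘ suc)) (suc n)) ⟩
    const (σ 0) *ₚ toeplitzDet (K-series ∘ suc) (suc n)
      ≈⟨ const-σ₀ (toeplitzDet (K-series ∘ suc) (suc n)) ⟩
    toeplitzDet (K-series ∘ suc) (suc n) ∎
    where
    open ≈-Reasoning P.setoid
    scaled : Matrix (suc n)
    scaled i j = const (ρ (suc (toℕ i))) *ₚ
      (const (σ (toℕ j)) *ₚ toeplitz (K-series ∘ suc) (toℕ i) (toℕ j))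

    scale≈const : ((1# * σ (suc n)) · F (suc n)) ≈ₚ (const (σ (suc n)) *ₚ F (suc n))
    scale≈const m = trans (coeff-· (1# * σ (suc n)) (F (suc n)) m)
      (trans (*-congʳ (*-identityˡ _)) (sym (coeff-const-* (σ (suc n)) (F (suc n)) m)))

    const-σ₀ : ∀ p → (const (σ 0) *ₚ p) ≈ₚ p
    const-σ₀ p m = trans (coeff-const-* (σ 0) p m) (trans (*-congʳ σ₀≈1) (*-identityˡ _))
      where
      σ₀≈1 : σ 0 ≈ 1#
      σ₀≈1 = inverse-unique (*-recip (ρ#0 0)) (trans (*-identityʳ _) ρ₀≈1)

lemma2p2 :
    ∀ {c ℓ₁ ℓ₂} (𝔽 : HeytingField c ℓ₁ ℓ₂) →
    let open HeytingField 𝔽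
        open Numbers 𝔽
        module S = RawRing seriesRing
    in
    (ρ : ℕ → Carrier) (ρ#0 : ∀ n → ρ n # 0#) → ρ 0 ≈ 1# →
    (K : ℕ → Poly) →
    let open Hessenberg ρ ρ#0 K
    in IsReciprocal seriesRing F-series (S.1# S.+ (S.- K-series))
lemma2p2 𝔽 ρ ρ#0 ρ₀≈1 K = fixpoint⇒reciprocal S F-series K-series fixpoint
  where
  open Numbers 𝔽
  open Hessenberg ρ ρ#0 K
  open HessenbergProperties 𝔽 ρ ρ#0 K using (F-series≈toeplitzDet)
  open PolynomialProperties
    (HeytingCommutativeRing.commutativeRing (HeytingField.heytingCommutativeRing 𝔽))
    using (polyCommutativeRing)
  open DeterminantProperties polyCommutativeRing using (toeplitzDet; toeplitzDet-fixpoint)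

  S : CommutativeRing _ _
  S = SeriesProperties.seriesCommutativeRing polyCommutativeRing

  module S = CommutativeRing S

  t : Series
  t = toeplitzDet (K-series ∘ suc)

  -- The fixed-point equation of `t` is carried over to `F-series` by replacing `t` on both sides;
  -- the constant term of `K-series` is `[]`, all of whose coefficients are zero.
  fixpoint : F-series S.≈ (S.1# S.+ (K-series S.* F-series))
  fixpoint = begin
    F-series                        ≈⟨ F-series≈toeplitzDet ρ₀≈1 ⟩
    t                               ≈⟨ toeplitzDet-fixpoint K-series (λ _ → HeytingField.refl 𝔽) ⟩
    S.1# S.+ (K-series S.* t)       ≈⟨ S.+-congˡ {S.1#} {K-series S.* t} {K-series S.* F-series}
                                         (S.*-congˡ {K-series} {t} {F-series}
                                           (S.sym {F-series} {t} (F-series≈toeplitzDet ρ₀≈1))) ⟩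
    S.1# S.+ (K-series S.* F-series) ∎
    where open ≈-Reasoning S.setoid
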